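{- The logic $\mathrm{FO}[\leq, \mathrm{fin}]$ has the independence property.
   Context: Notation: $\mathbb{N} = \{0,1,2,\ldots\}$ and $[n] = \{0,1,\ldots,n-1\}$. A $k$-ary numerical predicate (a relation symbol together with an interpretation in $[n]^k$ for each universe size $n$) is unvaried if there is a set $E \subseteq \mathbb{N}^k$ such that its interpretation on universes of size $n$ is $E \cap [n]^k$ for every $n$; it is then identified with $E$, and it can also be interpreted on the infinite universe $\mathbb{N}$ as $E$ itself. The order $\leq$ is unvaried. An unvaried predicate $P \subseteq \mathbb{N}^k$ is of finite degree if every $n \in \mathbb{N}$ appears in only finitely many tuples of $P$; $\mathrm{fin}$ is the class of all finite-degree predicates (of all arities). For a set $\mathcal{N}$ of numerical predicates, $\mathrm{FO}[\mathcal{N}]$ is the set of first-order formulas (over words) built using the symbols of $\mathcal{N}$ and unary letter predicates, one for each letter of an alphabet. In $\mathrm{FO}[\leq,\mathrm{fin}]$ the allowed numerical predicates are $\leq$ and all predicates in $\mathrm{fin}$. Independence property: let $\mathcal{N}$ be a set of unvaried numerical predicates, and let $\vec{x}, \vec{y}$ be two vectors of first-order variables of size $k$ and $\ell$ respectively. A formula $\phi(\vec{x},\vec{y})$ of $\mathrm{FO}[\mathcal{N}]$, over a single-letter alphabet, has the independence property if for all $n > 0$ there are vectors $\vec{a}_0, \vec{a}_1, \ldots, \vec{a}_{n-1}$, each in $\mathbb{N}^k$, such that for every $M \subseteq [n]$ there is a vector $\vec{b}_M \in \mathbb{N}^\ell$ such that, for all $i \in [n]$, \[\langle \mathbb{N},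 \vec{x} := \vec{a}_i, \vec{y} := \vec{b}_M\rangle \models \phi \quad\text{iff}\quad i \in M.\] (The formula is evaluated over the infinite domain $\mathbb{N}$; this is well defined as only unvaried predicates are used and the letter predicates are irrelevant.) The logic $\mathrm{FO}[\mathcal{N}]$ has the independence property if it contains such a formula $\phi$. -}

module Defs where

open import Data.Empty using (⊥)
open import Data.Fin using (Fin)
open import Data.Fin.Subset using (Subset) renaming (_∈_ to _∈ˢ_)
open import Data.List using (List)
import Data.List.Membership.Propositional as List
open import Data.Nat using (ℕ; suc; _+_; _≤_; _>_)
open import Data.Product using (∃-syntax; Σ-syntax; _×_)
open import Data.Sum using (_⊎_)
open import Data.Unit using (⊤; tt)
open import Data.Vec using (Vec; []; _∷_; _++_; lookup; map)
open import Data.Vec.Membership.Propositional using (_∈_)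
open import Function.Bundles using (_⇔_)
open import Level using (0ℓ) renaming (suc to lsuc)
open import Relation.Binary.PropositionalEquality using (_≡_)
open import Relation.Nullary using (¬_)
open import Relation.Unary using (Pred)

-- An unvaried predicate is identified with the set E ⊆ ℕᵏ whose
-- restrictions E ∩ [n]ᵏ are its interpretations on finite universes.
UnvariedPredicate : ℕ → Set₁
UnvariedPredicate k = Pred (Vec ℕ k) 0ℓ

-- Sets of unvaried predicates, of all arities.
PredicateSet : Set₂
PredicateSet = ∀ {k} → Pred (UnvariedPredicate k) (lsuc 0ℓ)

-- Finiteness of the set of tuples of P in which n appears is given by a
-- list that contains all of them (and possibly other tuples).
FiniteDegree : ∀ {k} → UnvariedPredicate k → Set
FiniteDegree {k} P =
  ∀ n → ∃[ ts ] (∀ (t : Vec ℕ k) → P t → n ∈ t → t List.∈ ts)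

Leq : UnvariedPredicate 2
Leq (x ∷ y ∷ []) = x ≤ y

data ≤,fin : PredicateSet where
  leq : ≤,fin Leq
  fin : ∀ {k} {P : UnvariedPredicate k} → FiniteDegree P → ≤,fin P

-- FO A 𝒩 m: formulas of FO[𝒩] over words on the alphabet A, with free
-- variables among m de Bruijn indices; quantifiers bind index zero.
data FO (A : Set) (𝒩 : PredicateSet) (m : ℕ) : Set₁ where
  letter      : A → Fin m → FO A 𝒩 m
  numerical   : ∀ {k} (P : UnvariedPredicate k) → 𝒩 P → Vec (Fin m) k → FO A 𝒩 m
  _≡′_        : Fin m → Fin m → FO A 𝒩 m
  ⊥′          : FO A 𝒩 m
  ¬′_         : FO A 𝒩 m → FO A 𝒩 m
  _∧′_ _∨′_ _⇒′_ : FO A 𝒩 m → FO A 𝒩 m → FO A 𝒩 m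
  ∀′_ ∃′_     : FO A 𝒩 (suc m) → FO A 𝒩 m

-- Truth in the infinite word w, with ℕ as universe, under the assignment ρ.
infix 4 _,_⊨_

_,_⊨_ : ∀ {A : Set} {𝒩 : PredicateSet} {m} → (ℕ → A) → Vec ℕ m → FO A 𝒩 m → Set
w , ρ ⊨ letter a x        = w (lookup ρ x) ≡ a
w , ρ ⊨ numerical P _ xs  = P (map (lookup ρ) xs)
w , ρ ⊨ (x ≡′ y)          = lookup ρ x ≡ lookup ρ y
w , ρ ⊨ ⊥′                = ⊥
w , ρ ⊨ (¬′ φ)            = ¬ (w , ρ ⊨ φ)
w , ρ ⊨ (φ ∧′ ψ)          = (w , ρ ⊨ φ) × (w , ρ ⊨ ψ)
w , ρ ⊨ (φ ∨′ ψ)          = (w , ρ ⊨ φ) ⊎ (w , ρ ⊨ ψ)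
w , ρ ⊨ (φ ⇒′ ψ)          = (w , ρ ⊨ φ) → (w , ρ ⊨ ψ)
w , ρ ⊨ (∀′ φ)            = ∀ n → w , (n ∷ ρ) ⊨ φ
w , ρ ⊨ (∃′ φ)            = ∃[ n ] (w , (n ∷ ρ) ⊨ φ)

-- The single-letter alphabet is ⊤, which leaves only one word on ℕ.  The
-- first k free variables of φ form the vector x⃗ and the last ℓ form y⃗.
FormulaHasIP : ∀ {𝒩 : PredicateSet} k ℓ → FO ⊤ 𝒩 (k + ℓ) → Set
FormulaHasIP k ℓ φ =
  ∀ n → n > 0 →
  Σ[ a ∈ (Fin n → Vec ℕ k) ] (∀ (M : Subset n) →
    Σ[ b ∈ Vec ℕ ℓ ] (∀ (i : Fin n) →
      ((λ _ → tt) , (a i ++ b) ⊨ φ) ⇔ (i ∈ˢ M)))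

LogicHasIP : PredicateSet → Set₁
LogicHasIP 𝒩 = ∃[ k ] ∃[ ℓ ] ∃[ φ ] FormulaHasIP {𝒩} k ℓ φ

-- For each n, the pairs (n , n + i) with i < n and the numbers n + c with c < 2ⁿ
-- code the elements and the subsets of [n].  The triples n , n + i , n + c for which i
-- belongs to the subset coded by c form a predicate of finite degree, since a triple
-- containing e has n ≤ e.
module Submission where

open import Defs
open import Data.Bool.Base using (true)
open import Data.Fin.Base using (Fin; toℕ; finToFun; funToFin)
open import Data.Fin.Properties using (2↔Bool; toℕ-injective; finToFun-funToFin)
open import Data.Fin.Subset using (Subset; _∈_)
open import Data.List.Base using (List; upTo; allFin; concatMap; cartesianProductWith)
open import Data.List.Membership.Propositional using (lose) renaming (_∈_ to _∈ˡ_)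
open import Data.List.Membership.Propositional.Properties
  using (∈-allFin; ∈-upTo⁺; ∈-concatMap⁺; ∈-cartesianProductWith⁺)
open import Data.Nat.Base using (ℕ; suc; _+_; _^_; _≤_; s≤s)
open import Data.Nat.Properties using (≤-refl; m≤m+n; +-cancelˡ-≡)
open import Data.Product.Base using (∃-syntax; _×_; _,_)
open import Data.Vec.Base using (Vec; []; _∷_; lookup) renaming (allFin to allFinᵛ)
open import Data.Vec.Membership.Propositional using () renaming (_∈_ to _∈ᵛ_)
open import Data.Vec.Properties using ([]=⇒lookup; lookup⇒[]=; ∷-injective)
open import Data.Vec.Relation.Unary.Any using (here; there)
open import Function.Base using (_∘_)
open import Function.Bundles using (_⇔_; mk⇔; Inverse)
open import Function.Construct.Composition using (_⇔-∘_)
open import Relation.Binary.PropositionalEquality using (_≡_; refl; sym; trans; cong)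

open Inverse 2↔Bool using (to; from; strictlyInverseˡ)

subsetCode : ∀ {n} → Subset n → Fin (2 ^ n)
subsetCode M = funToFin (from ∘ lookup M)

Bit : ∀ {n} → Fin n → Fin (2 ^ n) → Set
Bit i c = to (finToFun c i) ≡ true

-- The base-two digits of the code are the entries of the characteristic vector of `M`, and
-- `finToFun` reads them back.
Bit-subsetCode : ∀ {n} (i : Fin n) (M : Subset n) → Bit i (subsetCode M) ⇔ i ∈ M
Bit-subsetCode i M = mk⇔
  (λ bit → lookup⇒[]= i M (trans (sym decode) bit))
  (λ i∈M → trans decode ([]=⇒lookup i∈M))
  where
  decode : to (finToFun (subsetCode M) i) ≡ lookup M i
  decode = trans (cong to (finToFun-funToFin (from ∘ lookup M) i))
                 (strictlyInverseˡ (lookup M i))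

-- The shift by `n` bounds `n` by every entry; the leading entry records the shift, so that `i` and
-- `c` can be recovered.
triple : ∀ n → Fin n → Fin (2 ^ n) → Vec ℕ 3
triple n i c = n ∷ n + toℕ i ∷ n + toℕ c ∷ []

BitTriple : UnvariedPredicate 3
BitTriple t = ∃[ n ] ∃[ i ] ∃[ c ] (t ≡ triple n i c × Bit i c)

BitTriple-triple : ∀ {n} (i : Fin n) (c : Fin (2 ^ n)) → BitTriple (triple n i c) ⇔ Bit i c
BitTriple-triple {n} i c = mk⇔ unpack (λ bit → n , i , c , refl , bit)
  where
  unpack : BitTriple (triple n i c) → Bit i c
  -- Equal first entries must be matched first: they give `i′` and `c′` the types of `i` and `c`.
  -- Cancelling `n` then identifies the indices.
  unpack (_ , i′ , c′ , eq , bit) with refl , eq₁ ← ∷-injective eq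
    with eqᵢ , eq₂ ← ∷-injective eq₁
    with eqc , _ ← ∷-injective eq₂
    with refl ← toℕ-injective (+-cancelˡ-≡ n _ _ eqᵢ)
       | refl ← toℕ-injective (+-cancelˡ-≡ n _ _ eqc) = bit

∈triple⇒≥ : ∀ {e n} {i : Fin n} {c} → e ∈ᵛ triple n i c → n ≤ e
∈triple⇒≥ (here refl)                 = ≤-refl
∈triple⇒≥ (there (here refl))         = m≤m+n _ _
∈triple⇒≥ (there (there (here refl))) = m≤m+n _ _

triples : ℕ → List (Vec ℕ 3)
triples n = cartesianProductWith (triple n) (allFin n) (allFin (2 ^ n))

BitTriple-finiteDegree : FiniteDegree BitTriple
-- Each `n` has finitely many triples, all listed whatever their bit. The bound is `suc e` because
-- `n` may equal `e`.
BitTriple-finiteDegree e = concatMap triples (upTo (suc e)) , covers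
  where
  covers : ∀ t → BitTriple t → e ∈ᵛ t → t ∈ˡ concatMap triples (upTo (suc e))
  covers _ (n , i , c , refl , _) e∈t =
    ∈-concatMap⁺ triples (lose (∈-upTo⁺ (s≤s (∈triple⇒≥ e∈t)))
      (∈-cartesianProductWith⁺ (triple n) (∈-allFin i) (∈-allFin c)))

proposition1 : LogicHasIP ≤,fin
proposition1 =
  -- The formula is one atom on the three variables in order. Each `a i` carries `n` and the shifted
  -- `i`, and `b` the shifted code of `M`, so `a i ++ b` computes to a `triple`.
  2 , 1 , numerical BitTriple (fin BitTriple-finiteDegree) (allFinᵛ 3) , λ n _ →
  (λ i → n ∷ n + toℕ i ∷ []) , λ M →
  (n + toℕ (subsetCode M) ∷ []) , λ i →
  Bit-subsetCode i M ⇔-∘ BitTriple-triple i (subsetCode M)
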